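{- Suppose that the following statement holds: for every integer $p\ge 1$, every graph $G$ on $n$ vertices with at least $(p-2)n-\binom{p-1}{2}+1$ edges either has a $K_p$ minor or is $(p-1)$-colorable. Then for every integer $p\ge 5$, every graph with no $K_p$ minor is $(2p-6)$-colorable.
   Context: All graphs are finite and simple. A graph $H$ is a minor of $G$ if $H$ can be obtained from a subgraph of $G$ by contracting edges. A graph is $c$-colorable if it has a proper vertex coloring with at most $c$ colors. -}

module Defs where

open import Data.Nat using (ℕ; zero; suc; _<_)
open import Data.Bool using (Bool; true; false; if_then_else_)
open import Data.Fin using (Fin; toℕ)
open import Data.Fin.Properties using (_<?_)
open import Data.List using (List; sum; map; allFin; filter; length; concatMap)
open import Data.Maybe using (Maybe; just; nothing)
open import Data.Product using (Σ; ∃; _×_; _,_)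
open import Relation.Binary.PropositionalEquality using (_≡_; _≢_)
open import Relation.Nullary using (¬_; does)

record Graph (n : ℕ) : Set where
  field
    adj   : Fin n → Fin n → Bool
    sym   : ∀ u v → adj u v ≡ adj v u
    irrefl : ∀ v → adj v v ≡ false
open Graph public using (adj)

edgeCount : ∀ {n} → Graph n → ℕ
edgeCount {n} G =
  length (filter (λ uv → Data.Product.proj₁ uv <? Data.Product.proj₂ uv)
    (filter (λ uv → Data.Bool._≟_ (adj G (Data.Product.proj₁ uv) (Data.Product.proj₂ uv)) true)
      (concatMap (λ u → map (λ v → u , v) (allFin n)) (allFin n))))

complete : (p : ℕ) → Graph p
complete p = record
  { adj = λ u v → Data.Bool.not (does (Data.Fin._≟_ u v))
  ; sym = symK
  ; irrefl = irrK }
  where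
  open import Relation.Binary.PropositionalEquality using (refl; sym)
  open import Relation.Nullary using (yes; no)
  symK : ∀ u v → Data.Bool.not (does (Data.Fin._≟_ u v)) ≡ Data.Bool.not (does (Data.Fin._≟_ v u))
  symK u v with Data.Fin._≟_ u v | Data.Fin._≟_ v u
  ... | yes _ | yes _ = refl
  ... | no _ | no _ = refl
  ... | yes e | no ne = Data.Empty.⊥-elim (ne (sym e))
    where import Data.Empty
  ... | no ne | yes e = Data.Empty.⊥-elim (ne (sym e))
    where import Data.Empty
  irrK : ∀ v → Data.Bool.not (does (Data.Fin._≟_ v v)) ≡ false
  irrK v with Data.Fin._≟_ v v
  ... | yes _ = refl
  ... | no ne = Data.Empty.⊥-elim (ne refl)
    where import Data.Empty

-- Walks inside a vertex set S (given as a predicate): u can reach v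
-- using only vertices of S (u, v themselves assumed in S by the user).
data ReachIn {n} (G : Graph n) (S : Fin n → Set) : Fin n → Fin n → Set where
  here : ∀ {v} → ReachIn G S v v
  step : ∀ {u w v} → adj G u w ≡ true → S w → ReachIn G S w v → ReachIn G S u v

-- Minor model of H in G (standard branch-set formulation of
-- "H is obtained from a subgraph of G by contracting edges"):
-- β assigns each vertex of G to at most one vertex of H (branch sets
-- are thus disjoint); every branch set is nonempty and connected in G,
-- and for every edge hh' of H some edge of G joins the two branch sets.
record MinorModel {m n} (H : Graph m) (G : Graph n) : Set where
  field
    β         : Fin n → Maybe (Fin m)
    nonempty  : ∀ h → ∃ λ v → β v ≡ just h
    connected : ∀ h u v → β u ≡ just h → β v ≡ just h →
                ReachIn G (λ w → β w ≡ just h) u v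
    edges     : ∀ h h' → adj H h h' ≡ true →
                ∃ λ u → ∃ λ v → β u ≡ just h × β v ≡ just h' × adj G u v ≡ true

IsMinor : ∀ {m n} → Graph m → Graph n → Set
IsMinor H G = MinorModel H G

HasKMinor : ∀ {n} → ℕ → Graph n → Set
HasKMinor p G = IsMinor (complete p) G

Colorable : ∀ {n} → ℕ → Graph n → Set
Colorable {n} c G = ∃ λ (f : Fin n → Fin c) → ∀ u v → adj G u v ≡ true → f u ≢ f v

{-# OPTIONS --safe #-}

-- The hypothesis already implies Hadwiger's conjecture, so that p ∸ 1 ≤ 2p ∸ 6
-- colours suffice. The bound (p-2)n of Mader fails badly for large p: a random
-- graph D on 12Q vertices has at least 30Q² edges but, for Q large, no K_{2Q}
-- minor. Given G without a K_p minor, join it with the complete graph on 2Q - p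
-- vertices, which raises both the Hadwiger number and the chromatic number by
-- 2Q - p, and take the disjoint union with D. The result has no K_{2Q} minor, and
-- its edges in D alone exceed the bound, so it is (2Q-1)-colourable; hence G is
-- (p-1)-colourable.
--
-- Minor-freeness of D is a union bound over all assignments β of vertices to
-- branch sets. Pair the first Q branch sets with the last Q: for each of the Q²
-- pairs some potential edge between the two sets must be present. These are
-- disjoint clauses in independent bits, and half of them are of bounded length s, so
-- they are all satisfied with probability at most (1 - 2⁻ˢ)^(Q²/2), which beats the
-- number (2Q+1)^(12Q) of assignments.
module Submission where

open import Defs
open import Data.Bool as Bool using (Bool; true; false; not; _∧_; _∨_; if_then_else_)
open import Data.Bool.Properties using (∨-comm)
open import Data.Fin as Fin using (Fin; zero; suc; toℕ; splitAt; _↑ˡ_; _↑ʳ_; punchIn; punchOut; combine; remQuot; inject≤)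
open import Data.Fin.Properties using (_≟_; _<?_; splitAt-↑ˡ; splitAt-↑ʳ; splitAt⁻¹-↑ˡ; splitAt⁻¹-↑ʳ; ↑ˡ-injective; ↑ʳ-injective; toℕ-↑ʳ; punchIn-injective; punchInᵢ≢i; punchIn-punchOut; punchOut-injective; remQuot-combine; combine-surjective; inject≤-injective)
open import Data.Integer as ℤ using (ℤ; +_; +≤+) renaming (_+_ to _+ℤ_; _-_ to _-ℤ_; _*_ to _*ℤ_; _≤_ to _≤ℤ_)
import Data.Integer.Properties as ℤ
open import Data.List as List using (List; []; _∷_; _++_; length; filter; concatMap; map; allFin; tabulate; cartesianProductWith)
open import Data.List.Membership.Propositional using (_∈_)
open import Data.List.Membership.Propositional.Properties using (∈-cartesianProductWith⁺; ∈-map⁺; ∈-allFin)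
open import Data.List.Properties using (filter-++; length-++; length-map; length-tabulate; map-tabulate)
open import Data.List.Relation.Unary.Any using (here; there)
open import Data.Maybe using (Maybe; just; nothing; _>>=_)
open import Data.Nat as ℕ using (ℕ; zero; suc; _+_; _*_; _^_; _∸_; _≤_; _<_; _<ᵇ_; z≤n; s≤s)
open import Data.Nat.Combinatorics using (_C_)
open import Data.Nat.Properties hiding (_≟_; _<?_)
open import Data.Nat.Solver using (module +-*-Solver)
open import Data.Product using (∃; ∃₂; _×_; _,_; proj₁; proj₂)
open import Data.Sum using (_⊎_; inj₁; inj₂)
open import Data.Vec as Vec using (Vec; []; _∷_; lookup)
open import Data.Vec.Functional using (updateAt)
open import Data.Vec.Functional.Properties using (updateAt-updates; updateAt-minimal)
open import Data.Vec.Properties using (lookup∘tabulate; lookup-map)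
open import Function using (_∘_; id; const)
open import Function.Definitions using (Injective)
open import Relation.Binary.PropositionalEquality using (_≡_; _≢_; refl; sym; trans; cong; cong₂; subst; module ≡-Reasoning)
open import Relation.Nullary using (¬_; does; yes; no; contradiction)
open import Relation.Unary using (Decidable)

open import Algebra.Properties.CommutativeMonoid.Sum +-0-commutativeMonoid using () renaming (sum to ∑; sum-cong-≗ to ∑-cong; ∑-distrib-+ to ∑-+; sum-replicate-zero to ∑-replicate-zero)
open import Algebra.Properties.CommutativeMonoid.Sum *-1-commutativeMonoid using () renaming (sum to ∏; sum-cong-≗ to ∏-cong)
open +-*-Solver using (solve; _:+_; _:*_; _:=_; con)

-- Complete graphs and the join with a new dominating vertex.

complete-adj : ∀ {p} {h h′ : Fin p} → h ≢ h′ → adj (complete p) h h′ ≡ true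
complete-adj {h = h} {h′} h≢h′ with h ≟ h′
... | yes h≡h′ = contradiction h≡h′ h≢h′
... | no _ = refl

complete-adj⁻ : ∀ {p} {h h′ : Fin p} → adj (complete p) h h′ ≡ true → h ≢ h′
complete-adj⁻ {h = h} {h′} eq with h ≟ h′
complete-adj⁻ () | yes _
complete-adj⁻ _ | no h≢h′ = h≢h′

module _ {n} (G : Graph n) where

  cone-adj : Fin (suc n) → Fin (suc n) → Bool
  cone-adj zero    zero    = false
  cone-adj zero    (suc v) = true
  cone-adj (suc u) zero    = true
  cone-adj (suc u) (suc v) = adj G u v

  cone : Graph (suc n)
  cone = record { adj = cone-adj ; sym = s ; irrefl = i }
    where
    s : ∀ u v → cone-adj u v ≡ cone-adj v u
    s zero    zero    = refl
    s zero    (suc v) = refl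
    s (suc u) zero    = refl
    s (suc u) (suc v) = Graph.sym G u v
    i : ∀ v → cone-adj v v ≡ false
    i zero    = refl
    i (suc v) = Graph.irrefl G v

  -- The colour of the apex occurs on no other vertex, so it can be punched out of the palette.
  cone-colorable⁻ : ∀ {c} → Colorable (suc c) cone → Colorable c G
  cone-colorable⁻ {c} (f , proper) =
    (λ v → punchOut (apex≢ v)) ,
    (λ u v uv eq → proper (suc u) (suc v) uv (punchOut-injective (apex≢ u) (apex≢ v) eq))
    where
    apex≢ : ∀ v → f zero ≢ f (suc v)
    apex≢ v = proper zero (suc v) refl

  module _ {p} (M : MinorModel (complete (suc p)) cone) where
    open MinorModel M

    private
      apexLabel : Maybe (Fin (suc p)) → Fin (suc p)
      apexLabel (just h) = h
      -- If the apex lies in no branch set, any branch set may be discarded; number `zero` is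
      -- chosen.
      apexLabel nothing  = zero

      h₀ : Fin (suc p)
      h₀ = apexLabel (β zero)

      drop : Fin (suc p) → Maybe (Fin p)
      drop h with h₀ ≟ h
      ... | yes _ = nothing
      ... | no ≢h = just (punchOut ≢h)

      drop-just : ∀ {h k} → drop h ≡ just k → h ≡ punchIn h₀ k
      drop-just {h} eq with h₀ ≟ h
      drop-just () | yes _
      drop-just refl | no ≢h = sym (punchIn-punchOut ≢h)

      drop-punchIn : ∀ k → drop (punchIn h₀ k) ≡ just k
      drop-punchIn k with h₀ ≟ punchIn h₀ k
      ... | yes eq = contradiction (sym eq) (punchInᵢ≢i h₀ k)
      ... | no ≢h  = cong just (punchIn-injective h₀ _ _ (punchIn-punchOut ≢h))

      β′ : Fin n → Maybe (Fin p)
      β′ v = β (suc v) >>= drop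

      β′⇒β : ∀ {v k} → β′ v ≡ just k → β (suc v) ≡ just (punchIn h₀ k)
      β′⇒β {v} eq with β (suc v)
      β′⇒β eq | just h = cong just (drop-just eq)

      β⇒β′ : ∀ {v k} → β (suc v) ≡ just (punchIn h₀ k) → β′ v ≡ just k
      β⇒β′ {v} {k} eq rewrite eq = drop-punchIn k

      apex∉ : ∀ {k} → β zero ≢ just (punchIn h₀ k)
      apex∉ {k} eq = punchInᵢ≢i h₀ k (sym (cong apexLabel eq))

      inside : ∀ {k} u → β u ≡ just (punchIn h₀ k) → ∃ λ v → u ≡ suc v × β′ v ≡ just k
      inside zero    eq = contradiction eq apex∉
      inside (suc v) eq = v , refl , β⇒β′ eq

      reach : ∀ {k x u v} → ReachIn cone (λ w → β w ≡ just (punchIn h₀ k)) x (suc v) →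
              x ≡ suc u → ReachIn G (λ w → β′ w ≡ just k) u v
      reach here refl = here
      reach (step a b r) refl with inside _ b
      ... | w , refl , b′ = step a b′ (reach r refl)

    -- Discarding the branch set of the apex leaves `p` sets that avoid the apex, so their walks and
    -- the edges joining them already lie in `G`.
    cone-minor⁻ : MinorModel (complete p) G
    cone-minor⁻ = record
      { β         = β′
      ; nonempty  = ne
      ; connected = λ k u v bu bv → reach (connected _ _ _ (β′⇒β bu) (β′⇒β bv)) refl
      ; edges     = ed }
      where
      ne : ∀ k → ∃ λ v → β′ v ≡ just k
      ne k with nonempty (punchIn h₀ k)
      ... | u , bu with inside u bu
      ...   | v , _ , bv = v , bv
      ed : ∀ k k′ → adj (complete p) k k′ ≡ true →
           ∃ λ u → ∃ λ v → β′ u ≡ just k × β′ v ≡ just k′ × adj G u v ≡ true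
      ed k k′ kk′ with edges (punchIn h₀ k) (punchIn h₀ k′)
                         (complete-adj (complete-adj⁻ kk′ ∘ punchIn-injective h₀ k k′))
      ... | x , y , bx , by , xy with inside x bx | inside y by
      ...   | u , refl , bu | v , refl , bv = u , v , bu , bv , xy

cones : ∀ {n} t → Graph n → Graph (t + n)
cones zero    G = G
cones (suc t) G = cone (cones t G)

cones-minor⁻ : ∀ {n p} t {G : Graph n} → HasKMinor (t + p) (cones t G) → HasKMinor p G
cones-minor⁻ zero    M = M
cones-minor⁻ (suc t) M = cones-minor⁻ t (cone-minor⁻ (cones t _) M)

cones-colorable⁻ : ∀ {n c} t {G : Graph n} → Colorable (t + c) (cones t G) → Colorable c G
cones-colorable⁻ zero    f = f
cones-colorable⁻ (suc t) f = cones-colorable⁻ t (cone-colorable⁻ (cones t _) f)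

-- Disjoint unions.

-- The hypotheses say that ι embeds A in G as a union of connected components.
module _ {a n} (A : Graph a) (G : Graph n) (ι : Fin a → Fin n)
         (ι-injective : Injective _≡_ _≡_ ι)
         (ι-adj : ∀ x y → adj G (ι x) (ι y) ≡ adj A x y)
         (ι-closed : ∀ x w → adj G (ι x) w ≡ true → ∃ λ y → w ≡ ι y) where

  private
    reach-image : ∀ {S x u v} → ReachIn G S u v → u ≡ ι x → ∃ λ y → v ≡ ι y
    reach-image {x = x} here refl = x , refl
    reach-image (step a _ r) refl = reach-image r (proj₂ (ι-closed _ _ a))

    reach⁻ : ∀ {S : Fin n → Set} {x y u v} → ReachIn G S u v → u ≡ ι x → v ≡ ι y →
             ReachIn A (S ∘ ι) x y
    reach⁻ {x = x} here refl eq = subst (ReachIn A _ x) (ι-injective eq) here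
    reach⁻ (step a s r) refl eq with ι-closed _ _ a
    ... | z , refl = step (trans (sym (ι-adj _ z)) a) s (reach⁻ r refl eq)

  -- A connected branch set that meets the image of `ι` stays inside it. Any two branch sets of a
  -- complete graph are joined by an edge, so one set in the image pulls in all the others.
  component-minor : ∀ {p} (M : MinorModel (complete p) G) {x₀ h₀} →
                    MinorModel.β M (ι x₀) ≡ just h₀ → MinorModel (complete p) A
  component-minor {p} M {x₀} {h₀} b₀ = record
    { β         = β ∘ ι
    ; nonempty  = ne
    ; connected = λ h x y bx by → reach⁻ (connected h _ _ bx by) refl refl
    ; edges     = ed }
    where
    open MinorModel M
    same-branch : ∀ {h x u} → β (ι x) ≡ just h → β u ≡ just h → ∃ λ y → u ≡ ι y
    same-branch bx bu = reach-image (connected _ _ _ bx bu) refl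
    ne : ∀ h → ∃ λ x → β (ι x) ≡ just h
    ne h with h₀ ≟ h
    ... | yes refl = x₀ , b₀
    ... | no h₀≢h with edges h₀ h (complete-adj h₀≢h)
    ...   | u , v , bu , bv , uv with same-branch b₀ bu
    ...     | x , refl with ι-closed x v uv
    ...       | y , refl = y , bv
    ed : ∀ h h′ → adj (complete p) h h′ ≡ true →
         ∃ λ x → ∃ λ y → β (ι x) ≡ just h × β (ι y) ≡ just h′ × adj A x y ≡ true
    ed h h′ hh′ with edges h h′ hh′
    ... | u , v , bu , bv , uv with same-branch (proj₂ (ne h)) bu
    ...   | x , refl with ι-closed x v uv
    ...     | y , refl = x , y , bu , bv , trans (sym (ι-adj x y)) uv

module _ {m n} (G : Graph m) (H : Graph n) where

  ⊎-adj : Fin m ⊎ Fin n → Fin m ⊎ Fin n → Bool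
  ⊎-adj (inj₁ u) (inj₁ v) = adj G u v
  ⊎-adj (inj₁ _) (inj₂ _) = false
  ⊎-adj (inj₂ _) (inj₁ _) = false
  ⊎-adj (inj₂ u) (inj₂ v) = adj H u v

  disjointUnion : Graph (m + n)
  disjointUnion = record
    { adj    = λ u v → ⊎-adj (splitAt m u) (splitAt m v)
    ; sym    = λ u v → s (splitAt m u) (splitAt m v)
    ; irrefl = λ v → i (splitAt m v) }
    where
    s : ∀ u v → ⊎-adj u v ≡ ⊎-adj v u
    s (inj₁ u) (inj₁ v) = Graph.sym G u v
    s (inj₁ u) (inj₂ v) = refl
    s (inj₂ u) (inj₁ v) = refl
    s (inj₂ u) (inj₂ v) = Graph.sym H u v
    i : ∀ v → ⊎-adj v v ≡ false
    i (inj₁ v) = Graph.irrefl G v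
    i (inj₂ v) = Graph.irrefl H v

  adj-↑ˡ : ∀ u v → adj disjointUnion (u ↑ˡ n) (v ↑ˡ n) ≡ adj G u v
  adj-↑ˡ u v = cong₂ ⊎-adj (splitAt-↑ˡ m u n) (splitAt-↑ˡ m v n)

  adj-↑ʳ : ∀ u v → adj disjointUnion (m ↑ʳ u) (m ↑ʳ v) ≡ adj H u v
  adj-↑ʳ u v = cong₂ ⊎-adj (splitAt-↑ʳ m n u) (splitAt-↑ʳ m n v)

  closed-↑ˡ : ∀ u w → adj disjointUnion (u ↑ˡ n) w ≡ true → ∃ λ v → w ≡ v ↑ˡ n
  closed-↑ˡ u w uw rewrite splitAt-↑ˡ m u n with splitAt m w in eq
  ... | inj₁ v = v , sym (splitAt⁻¹-↑ˡ eq)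

  closed-↑ʳ : ∀ u w → adj disjointUnion (m ↑ʳ u) w ≡ true → ∃ λ v → w ≡ m ↑ʳ v
  closed-↑ʳ u w uw rewrite splitAt-↑ʳ m n u with splitAt m w in eq
  ... | inj₂ v = v , sym (splitAt⁻¹-↑ʳ eq)

  -- The element `h` picks out a branch set; the side holding one of its vertices holds the whole
  -- model.
  disjointUnion-minor⁻ : ∀ {p} → Fin p → HasKMinor p disjointUnion → HasKMinor p G ⊎ HasKMinor p H
  disjointUnion-minor⁻ h M with MinorModel.nonempty M h
  ... | w , bw with splitAt m w in eq
  ...   | inj₁ u = inj₁ (component-minor G disjointUnion (_↑ˡ n) (↑ˡ-injective n _ _) adj-↑ˡ closed-↑ˡ M
                           (trans (cong (MinorModel.β M) (splitAt⁻¹-↑ˡ eq)) bw))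
  ...   | inj₂ u = inj₂ (component-minor H disjointUnion (m ↑ʳ_) (↑ʳ-injective m _ _) adj-↑ʳ closed-↑ʳ M
                           (trans (cong (MinorModel.β M) (splitAt⁻¹-↑ʳ eq)) bw))

  disjointUnion-colorableˡ : ∀ {c} → Colorable c disjointUnion → Colorable c G
  disjointUnion-colorableˡ (f , proper) =
    (f ∘ (_↑ˡ n)) , λ u v uv → proper (u ↑ˡ n) (v ↑ˡ n) (trans (adj-↑ˡ u v) uv)

-- Counting edges by double sums.

𝟙 : Bool → ℕ
𝟙 b = if b then 1 else 0

∑-mono : ∀ {n} {f g : Fin n → ℕ} → (∀ i → f i ≤ g i) → ∑ f ≤ ∑ g
∑-mono {zero}  f≤g = z≤n
∑-mono {suc n} f≤g = +-mono-≤ (f≤g zero) (∑-mono (f≤g ∘ suc))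

∑-↑ʳ : ∀ m {n} (f : Fin (m + n) → ℕ) → ∑ (λ i → f (m ↑ʳ i)) ≤ ∑ f
∑-↑ʳ zero    f = ≤-refl
∑-↑ʳ (suc m) f = ≤-trans (∑-↑ʳ m (f ∘ suc)) (m≤n+m _ (f zero))

module _ {A : Set} {P Q : A → Set} (P? : Decidable P) (Q? : Decidable Q) where

  length-filter-filter : ∀ {n} (f : Fin n → A) →
    length (filter P? (filter Q? (tabulate f))) ≡ ∑ λ i → 𝟙 (does (P? (f i)) ∧ does (Q? (f i)))
  length-filter-filter {zero}  f = refl
  length-filter-filter {suc n} f with ih ← length-filter-filter (f ∘ suc) | does (Q? (f zero))
  length-filter-filter {suc n} f | false with does (P? (f zero))
  ... | true  = ih
  ... | false = ih
  length-filter-filter {suc n} f | true with does (P? (f zero))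
  ... | true  = cong suc ih
  ... | false = ih

  length-filter-concatMap : ∀ {B : Set} {n} (g : B → List A) (f : Fin n → B) →
    length (filter P? (filter Q? (concatMap g (tabulate f)))) ≡
    ∑ λ i → length (filter P? (filter Q? (g (f i))))
  length-filter-concatMap {n = zero}  g f = refl
  length-filter-concatMap {n = suc n} g f = begin
    length (filter P? (filter Q? (g (f zero) ++ rest)))
      ≡⟨ cong (length ∘ filter P?) (filter-++ Q? (g (f zero)) rest) ⟩
    length (filter P? (filter Q? (g (f zero)) ++ filter Q? rest))
      ≡⟨ cong length (filter-++ P? (filter Q? (g (f zero))) (filter Q? rest)) ⟩
    length (filter P? (filter Q? (g (f zero))) ++ filter P? (filter Q? rest))
      ≡⟨ length-++ (filter P? (filter Q? (g (f zero)))) ⟩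
    length (filter P? (filter Q? (g (f zero)))) + length (filter P? (filter Q? rest))
      ≡⟨ cong (λ o → length (filter P? (filter Q? (g (f zero)))) + o) (length-filter-concatMap g (f ∘ suc)) ⟩
    _ ∎
    where
    open ≡-Reasoning
    rest = concatMap g (tabulate (f ∘ suc))

_<ᶠ_ : ∀ {n} → Fin n → Fin n → Bool
u <ᶠ v = toℕ u <ᵇ toℕ v

does-≟-true : ∀ b → does (b Bool.≟ true) ≡ b
does-≟-true true  = refl
does-≟-true false = refl

-- The nested list filters become a sum indexed by `Fin n`, which can be compared entry by entry.
edgeCount-∑ : ∀ {n} (G : Graph n) → edgeCount G ≡ ∑ λ u → ∑ λ v → 𝟙 (u <ᶠ v ∧ adj G u v)
edgeCount-∑ {n} G = trans (length-filter-concatMap lt? adj? (λ u → map (u ,_) (allFin n)) id) (∑-cong row)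
  where
  open ≡-Reasoning
  lt? : Decidable (λ (uv : Fin n × Fin n) → proj₁ uv Fin.< proj₂ uv)
  lt? uv = proj₁ uv <? proj₂ uv
  adj? : Decidable (λ (uv : Fin n × Fin n) → adj G (proj₁ uv) (proj₂ uv) ≡ true)
  adj? uv = adj G (proj₁ uv) (proj₂ uv) Bool.≟ true
  row : ∀ u → length (filter lt? (filter adj? (map (u ,_) (allFin n)))) ≡ ∑ λ v → 𝟙 (u <ᶠ v ∧ adj G u v)
  row u = begin
    length (filter lt? (filter adj? (map (u ,_) (allFin n))))
      ≡⟨ cong (length ∘ filter lt? ∘ filter adj?) (map-tabulate id (u ,_)) ⟩
    length (filter lt? (filter adj? (tabulate (u ,_))))
      ≡⟨ length-filter-filter lt? adj? (u ,_) ⟩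
    (∑ λ v → 𝟙 (u <ᶠ v ∧ does (adj G u v Bool.≟ true)))
      ≡⟨ ∑-cong (λ v → cong (λ b → 𝟙 (u <ᶠ v ∧ b)) (does-≟-true (adj G u v))) ⟩
    (∑ λ v → 𝟙 (u <ᶠ v ∧ adj G u v)) ∎

<ᵇ-+ : ∀ k m n → (k + m <ᵇ k + n) ≡ (m <ᵇ n)
<ᵇ-+ zero    m n = refl
<ᵇ-+ (suc k) m n = <ᵇ-+ k m n

edgeCount-disjointUnionʳ : ∀ {m n} (G : Graph m) (H : Graph n) → edgeCount H ≤ edgeCount (disjointUnion G H)
edgeCount-disjointUnionʳ {m} {n} G H rewrite edgeCount-∑ H | edgeCount-∑ (disjointUnion G H) =
  ≤-trans (∑-mono λ u → ≤-trans (≤-reflexive (∑-cong λ v → cong 𝟙 (cong₂ _∧_ (lt u v) (sym (adj-↑ʳ G H u v)))))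
                                (∑-↑ʳ m _))
          (∑-↑ʳ m _)
  where
  lt : ∀ (u v : Fin n) → (u <ᶠ v) ≡ ((m ↑ʳ u) <ᶠ (m ↑ʳ v))
  lt u v rewrite toℕ-↑ʳ m u | toℕ-↑ʳ m v = sym (<ᵇ-+ m (toℕ u) (toℕ v))

-- Sums over bit vectors and the union bound.

∑ᵇ : ∀ N → (Vec Bool N → ℕ) → ℕ
∑ᵇ zero    f = f []
∑ᵇ (suc N) f = ∑ᵇ N (f ∘ (false ∷_)) + ∑ᵇ N (f ∘ (true ∷_))

∑ᵇ-zero : ∀ N → ∑ᵇ N (const 0) ≡ 0
∑ᵇ-zero zero    = refl
∑ᵇ-zero (suc N) = cong₂ _+_ (∑ᵇ-zero N) (∑ᵇ-zero N)

∑ᵇ-+ : ∀ N (f g : Vec Bool N → ℕ) → ∑ᵇ N (λ x → f x + g x) ≡ ∑ᵇ N f + ∑ᵇ N g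
∑ᵇ-+ zero    f g = refl
∑ᵇ-+ (suc N) f g
  rewrite ∑ᵇ-+ N (f ∘ (false ∷_)) (g ∘ (false ∷_)) | ∑ᵇ-+ N (f ∘ (true ∷_)) (g ∘ (true ∷_)) =
  solve 4 (λ a b c d → (a :+ b) :+ (c :+ d) := (a :+ c) :+ (b :+ d)) refl
    (∑ᵇ N (f ∘ (false ∷_))) (∑ᵇ N (g ∘ (false ∷_))) (∑ᵇ N (f ∘ (true ∷_))) (∑ᵇ N (g ∘ (true ∷_)))

-- Flipping all bits permutes the bit vectors, so the complement of a uniformly random graph is
-- again uniformly random.
∑ᵇ-not : ∀ N (f : Vec Bool N → ℕ) → ∑ᵇ N (f ∘ Vec.map not) ≡ ∑ᵇ N f
∑ᵇ-not zero    f = refl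
∑ᵇ-not (suc N) f =
  trans (cong₂ _+_ (∑ᵇ-not N (f ∘ (true ∷_))) (∑ᵇ-not N (f ∘ (false ∷_))))
        (+-comm (∑ᵇ N (f ∘ (true ∷_))) _)

-- The probabilistic method: an average below 1 stays below 1 on one half of the cube, and so on
-- down to a single vector, where a natural number below 1 is 0.
∑ᵇ<2^⇒zero : ∀ N (f : Vec Bool N → ℕ) → ∑ᵇ N f < 2 ^ N → ∃ λ x → f x ≡ 0
∑ᵇ<2^⇒zero zero    f f<1 = [] , n<1⇒n≡0 f<1
∑ᵇ<2^⇒zero (suc N) f f<  with ∑ᵇ N (f ∘ (false ∷_)) ℕ.<? 2 ^ N | ∑ᵇ N (f ∘ (true ∷_)) ℕ.<? 2 ^ N
... | yes l | _     = let x , eq = ∑ᵇ<2^⇒zero N _ l in (false ∷ x) , eq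
... | no _  | yes r = let x , eq = ∑ᵇ<2^⇒zero N _ r in (true ∷ x) , eq
... | no l  | no r  = contradiction f<
  (≤⇒≯ (≤-trans (≤-reflexive (cong (λ o → 2 ^ N + o) (+-identityʳ _))) (+-mono-≤ (≮⇒≥ l) (≮⇒≥ r))))

module _ {B : Set} where

  ∑ˡ : (B → ℕ) → List B → ℕ
  ∑ˡ f []       = 0
  ∑ˡ f (b ∷ bs) = f b + ∑ˡ f bs

  ∑ˡ≡0 : ∀ {f bs b} → ∑ˡ f bs ≡ 0 → b ∈ bs → f b ≡ 0
  ∑ˡ≡0 {f} {b ∷ bs} eq (here refl) = m+n≡0⇒m≡0 (f b) eq
  ∑ˡ≡0 {f} {b ∷ bs} eq (there b∈)  = ∑ˡ≡0 (m+n≡0⇒n≡0 (f b) eq) b∈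

  -- The pair `c`, `d` stands for the common bound `d / c` on all terms, written without division.
  union-bound : ∀ {N} (g : B → Vec Bool N → ℕ) {c d} → (∀ b → ∑ᵇ N (g b) * c ≤ d) →
                ∀ bs → ∑ᵇ N (λ x → ∑ˡ (λ b → g b x) bs) * c ≤ length bs * d
  union-bound {N} g {c} {d} g≤ []       = ≤-reflexive (cong (_* c) (∑ᵇ-zero N))
  union-bound {N} g {c} {d} g≤ (b ∷ bs) = begin
    ∑ᵇ N (λ x → g b x + ∑ˡ (λ b → g b x) bs) * c
      ≡⟨ cong (_* c) (∑ᵇ-+ N (g b) _) ⟩
    (∑ᵇ N (g b) + ∑ᵇ N (λ x → ∑ˡ (λ b → g b x) bs)) * c
      ≡⟨ *-distribʳ-+ c (∑ᵇ N (g b)) _ ⟩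
    ∑ᵇ N (g b) * c + ∑ᵇ N (λ x → ∑ˡ (λ b → g b x) bs) * c
      ≤⟨ +-mono-≤ (g≤ b) (union-bound g g≤ bs) ⟩
    d + length bs * d ∎
    where open ≤-Reasoning

-- Disjoint clauses of random bits.

∏-*-^ : ∀ {m} (f : Fin m → ℕ) k → ∏ f * k ^ m ≡ ∏ λ i → f i * k
∏-*-^ {zero}  f k = refl
∏-*-^ {suc m} f k = trans
  (solve 4 (λ a b c d → (a :* b) :* (c :* d) := (a :* c) :* (b :* d)) refl (f zero) (∏ (f ∘ suc)) k (k ^ m))
  (cong (f zero * k *_) (∏-*-^ (f ∘ suc) k))

-- A product is linear in its factor at `d`, and the three families agree elsewhere. It serves to
-- average over the two values of one revealed bit.
∏-average : ∀ {m} (f g h : Fin m → ℕ) d → (∀ c → c ≢ d → f c ≡ h c × g c ≡ h c) →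
            f d + g d ≤ 2 * h d → ∏ f + ∏ g ≤ 2 * ∏ h
∏-average f g h zero off at
  rewrite ∏-cong {x = f ∘ suc} {h ∘ suc} (λ i → proj₁ (off (suc i) λ ()))
        | ∏-cong {x = g ∘ suc} {h ∘ suc} (λ i → proj₂ (off (suc i) λ ())) = begin
  f zero * T + g zero * T ≡⟨ *-distribʳ-+ T (f zero) (g zero) ⟨
  (f zero + g zero) * T   ≤⟨ *-monoˡ-≤ T at ⟩
  2 * h zero * T          ≡⟨ *-assoc 2 (h zero) T ⟩
  2 * (h zero * T)        ∎
  where
  open ≤-Reasoning
  T = ∏ (h ∘ suc)
∏-average f g h (suc d) off at
  rewrite proj₁ (off zero λ ()) | proj₂ (off zero λ ()) = begin
  h zero * ∏ (f ∘ suc) + h zero * ∏ (g ∘ suc) ≡⟨ *-distribˡ-+ (h zero) _ _ ⟨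
  h zero * (∏ (f ∘ suc) + ∏ (g ∘ suc))        ≤⟨ *-monoʳ-≤ (h zero) (∏-average _ _ (h ∘ suc) d (λ c c≢d → off (suc c) λ { refl → c≢d refl }) at) ⟩
  h zero * (2 * ∏ (h ∘ suc))                  ≡⟨ solve 2 (λ a b → a :* (con 2 :* b) := con 2 :* (a :* b)) refl (h zero) (∏ (h ∘ suc)) ⟩
  2 * (h zero * ∏ (h ∘ suc))                  ∎
  where open ≤-Reasoning

-- satProb s r / 2 ^ s is the probability 1 − 2⁻ʳ that a clause of r
-- fair bits is satisfied, rounded up to 1 when r > s.
satProb : ℕ → ℕ → ℕ
satProb s       zero    = 0
satProb zero    (suc r) = 1
satProb (suc s) (suc r) = 2 ^ s + satProb s r

-- A fresh bit either satisfies the clause or leaves `r` bits to do so, each with probability 1/2.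
-- Equality holds except at `r ≡ s`, where the rounding up to 1 sets in.
satProb-step : ∀ s r → satProb s r + 2 ^ s ≤ 2 * satProb s (suc r)
satProb-step zero    zero    = s≤s z≤n
satProb-step zero    (suc r) = ≤-refl
satProb-step (suc s) zero    = *-monoʳ-≤ 2 (m≤m+n (2 ^ s) 0)
satProb-step (suc s) (suc r) = begin
  2 ^ s + satProb s r + 2 * 2 ^ s     ≡⟨ solve 2 (λ a b → a :+ b :+ con 2 :* a := con 2 :* a :+ (b :+ a)) refl (2 ^ s) (satProb s r) ⟩
  2 * 2 ^ s + (satProb s r + 2 ^ s)   ≤⟨ +-monoʳ-≤ (2 * 2 ^ s) (satProb-step s r) ⟩
  2 * 2 ^ s + 2 * satProb s (suc r)   ≡⟨ *-distribˡ-+ 2 (2 ^ s) _ ⟨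
  2 * (2 ^ s + satProb s (suc r))     ∎
  where open ≤-Reasoning

satProb≤ : ∀ s r → satProb s r ≤ 2 ^ s
satProb≤ s       zero    = z≤n
satProb≤ zero    (suc r) = ≤-refl
satProb≤ (suc s) (suc r) = +-monoʳ-≤ (2 ^ s) (≤-trans (satProb≤ s r) (m≤m+n _ 0))

satProb< : ∀ {s r} → r ≤ s → satProb s r < 2 ^ s
satProb< {s} z≤n             = m^n>0 2 s
satProb< {suc s} (s≤s r≤s) = +-monoʳ-< (2 ^ s) (<-≤-trans (satProb< r≤s) (m≤m+n _ 0))

module _ {m : ℕ} where

  indicator : Fin m → Fin m → ℕ
  indicator d c = if does (c ≟ d) then 1 else 0

  occurrences : ∀ {N} → Vec (Maybe (Fin m)) N → Fin m → ℕ
  occurrences []             c = 0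
  occurrences (nothing ∷ ls) c = occurrences ls c
  occurrences (just d ∷ ls)  c = indicator d c + occurrences ls c

  -- The number (0 or 1) telling whether every live clause has a true
  -- bit; the label of a bit is the clause that it belongs to.
  satisfied : ∀ {N} → (Fin m → Bool) → Vec (Maybe (Fin m)) N → Vec Bool N → ℕ
  satisfied live []             []          = ∏ λ c → if live c then 0 else 1
  satisfied live (nothing ∷ ls) (b ∷ x)     = satisfied live ls x
  satisfied live (just d ∷ ls)  (false ∷ x) = satisfied live ls x
  satisfied live (just d ∷ ls)  (true ∷ x)  = satisfied (updateAt live d (const false)) ls x

  satisfied>0 : ∀ {N} live (ls : Vec (Maybe (Fin m)) N) x →
    (∀ c → live c ≡ true → ∃ λ i → lookup ls i ≡ just c × lookup x i ≡ true) →
    0 < satisfied live ls x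
  -- No bits are left, so `hit` at a live clause would give an element of `Fin 0`.
  satisfied>0 live [] [] hit = positive λ c → dead c λ l → noFin (proj₁ (hit c l))
    where
    noFin : ¬ Fin 0
    noFin ()
    dead : ∀ c → (live c ≢ true) → 0 < (if live c then 0 else 1)
    dead c ≢true with live c
    ... | true  = contradiction refl ≢true
    ... | false = s≤s z≤n
    positive : ∀ {m} {f : Fin m → ℕ} → (∀ c → 0 < f c) → 0 < ∏ f
    positive {zero}  f>0 = s≤s z≤n
    positive {suc m} f>0 = *-mono-≤ (f>0 zero) (positive (f>0 ∘ suc))
  satisfied>0 live (nothing ∷ ls) (b ∷ x) hit = satisfied>0 live ls x hit′
    where
    hit′ : ∀ c → live c ≡ true → ∃ λ i → lookup ls i ≡ just c × lookup x i ≡ true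
    hit′ c l with hit c l
    ... | suc i , p = i , p
  satisfied>0 live (just d ∷ ls) (false ∷ x) hit = satisfied>0 live ls x hit′
    where
    hit′ : ∀ c → live c ≡ true → ∃ λ i → lookup ls i ≡ just c × lookup x i ≡ true
    hit′ c l with hit c l
    ... | suc i , p = i , p
  satisfied>0 live (just d ∷ ls) (true ∷ x) hit = satisfied>0 _ ls x hit′
    where
    hit′ : ∀ c → updateAt live d (const false) c ≡ true → ∃ λ i → lookup ls i ≡ just c × lookup x i ≡ true
    hit′ c l with c ≟ d
    ... | yes refl = contradiction (trans (sym l) (updateAt-updates c live)) λ ()
    ... | no c≢d with hit c (trans (sym (updateAt-minimal c d live c≢d)) l)
    ...   | zero  , refl , _ = contradiction refl c≢d
    ...   | suc i , p = i , p

  -- Up to the factor `2 ^ s`, a bound on the conditional probability that clause `c` ends up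
  -- satisfied once the bits before `ls` are revealed; a clause that is no longer live is satisfied
  -- already.
  weight : ∀ {N} → ℕ → (Fin m → Bool) → Vec (Maybe (Fin m)) N → Fin m → ℕ
  weight s live ls c = if live c then satProb s (occurrences ls c) else 2 ^ s

  -- Revealing the bits one by one, the product of the weights is a supermartingale.
  ∑ᵇ-satisfied : ∀ {N} s live (ls : Vec (Maybe (Fin m)) N) →
                 ∑ᵇ N (satisfied live ls) * (2 ^ s) ^ m ≤ 2 ^ N * ∏ (weight s live ls)
  ∑ᵇ-satisfied s live [] = begin
    (∏ λ c → if live c then 0 else 1) * (2 ^ s) ^ m ≡⟨ ∏-*-^ {m} _ (2 ^ s) ⟩
    (∏ λ c → (if live c then 0 else 1) * 2 ^ s)     ≡⟨ ∏-cong (λ c → base (live c)) ⟩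
    ∏ (weight s live [])                            ≡⟨ *-identityˡ _ ⟨
    1 * ∏ (weight s live [])                        ∎
    where
    open ≤-Reasoning
    base : ∀ b → (if b then 0 else 1) * 2 ^ s ≡ (if b then 0 else 2 ^ s)
    base true  = refl
    base false = *-identityˡ (2 ^ s)
  ∑ᵇ-satisfied {suc N} s live (nothing ∷ ls) = begin
    (S + S) * (2 ^ s) ^ m          ≡⟨ solve 2 (λ a b → (a :+ a) :* b := con 2 :* (a :* b)) refl S ((2 ^ s) ^ m) ⟩
    2 * (S * (2 ^ s) ^ m)          ≤⟨ *-monoʳ-≤ 2 (∑ᵇ-satisfied s live ls) ⟩
    2 * (2 ^ N * ∏ (weight s live ls)) ≡⟨ *-assoc 2 (2 ^ N) _ ⟨
    2 * 2 ^ N * ∏ (weight s live ls)   ∎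
    where
    open ≤-Reasoning
    S = ∑ᵇ N (satisfied live ls)
  ∑ᵇ-satisfied {suc N} s live (just d ∷ ls) = begin
    (S + S′) * (2 ^ s) ^ m                 ≡⟨ *-distribʳ-+ ((2 ^ s) ^ m) S S′ ⟩
    S * (2 ^ s) ^ m + S′ * (2 ^ s) ^ m     ≤⟨ +-mono-≤ (∑ᵇ-satisfied s live ls) (∑ᵇ-satisfied s live′ ls) ⟩
    2 ^ N * ∏ (weight s live ls) + 2 ^ N * ∏ (weight s live′ ls)
                                           ≡⟨ *-distribˡ-+ (2 ^ N) _ _ ⟨
    2 ^ N * (∏ (weight s live ls) + ∏ (weight s live′ ls))
                                           ≤⟨ *-monoʳ-≤ (2 ^ N) (∏-average _ _ (weight s live (just d ∷ ls)) d off at) ⟩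
    2 ^ N * (2 * ∏ (weight s live (just d ∷ ls)))
                                           ≡⟨ solve 2 (λ a b → a :* (con 2 :* b) := con 2 :* a :* b) refl (2 ^ N) (∏ (weight s live (just d ∷ ls))) ⟩
    2 * 2 ^ N * ∏ (weight s live (just d ∷ ls)) ∎
    where
    open ≤-Reasoning
    live′ = updateAt live d (const false)
    S = ∑ᵇ N (satisfied live ls)
    S′ = ∑ᵇ N (satisfied live′ ls)
    off : ∀ c → c ≢ d → weight s live ls c ≡ weight s live (just d ∷ ls) c ×
                        weight s live′ ls c ≡ weight s live (just d ∷ ls) c
    off c c≢d rewrite updateAt-minimal c d {const false} live c≢d with c ≟ d
    ... | yes c≡d = contradiction c≡d c≢d
    ... | no _    = refl , refl
    at : weight s live ls d + weight s live′ ls d ≤ 2 * weight s live (just d ∷ ls) d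
    at rewrite updateAt-updates d {const false} live with d ≟ d
    ... | no d≢d = contradiction refl d≢d
    ... | yes _ with live d
    ...   | true  = satProb-step s (occurrences ls d)
    ...   | false = +-monoʳ-≤ (2 ^ s) (m≤m+n (2 ^ s) 0)

∑-indicator : ∀ {m} (d : Fin m) → ∑ (indicator d) ≡ 1
∑-indicator {suc m} zero    = cong suc (∑-replicate-zero m)
∑-indicator {suc m} (suc d) = ∑-indicator d

∑-occurrences : ∀ {m N} (ls : Vec (Maybe (Fin m)) N) → ∑ (occurrences ls) ≤ N
∑-occurrences {m} []         = ≤-reflexive (∑-replicate-zero m)
∑-occurrences (nothing ∷ ls) = ≤-trans (∑-occurrences ls) (n≤1+n _)
∑-occurrences (just d ∷ ls)  = begin
  (∑ λ c → indicator d c + occurrences ls c)  ≡⟨ ∑-+ (indicator d) (occurrences ls) ⟩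
  ∑ (indicator d) + ∑ (occurrences ls)       ≡⟨ cong (_+ ∑ (occurrences ls)) (∑-indicator d) ⟩
  suc (∑ (occurrences ls))                   ≤⟨ s≤s (∑-occurrences ls) ⟩
  suc _ ∎
  where open ≤-Reasoning

-- Markov's inequality: a counts the clauses with at most s bits, b the others.
∏-satProb : ∀ {m} s {k} → 2 ^ s ≡ suc k → (r : Fin m → ℕ) →
  ∃₂ λ a b → a + b ≡ m × suc s * b ≤ ∑ r × ∏ (satProb s ∘ r) ≤ k ^ a * suc k ^ b
∏-satProb {zero}  s eq r = 0 , 0 , refl , ≤-reflexive (*-zeroʳ (suc s)) , ≤-refl
∏-satProb {suc m} s {k} eq r with ∏-satProb s eq (r ∘ suc) | r zero ≤? s
-- An integer below `2 ^ s ≡ suc k` is at most `k`: each short clause contributes a factor 1 - 2⁻ˢ.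
... | a , b , a+b , b≤ , ∏≤ | yes r≤s =
  suc a , b , cong suc a+b , ≤-trans b≤ (m≤n+m _ (r zero)) ,
  (begin
    satProb s (r zero) * ∏ (satProb s ∘ r ∘ suc) ≤⟨ *-mono-≤ (≤-pred (subst (satProb s (r zero) <_) eq (satProb< r≤s))) ∏≤ ⟩
    k * (k ^ a * suc k ^ b)                      ≡⟨ *-assoc k (k ^ a) _ ⟨
    k * k ^ a * suc k ^ b                        ∎)
  where open ≤-Reasoning
... | a , b , a+b , b≤ , ∏≤ | no r≰s =
  a , suc b , trans (+-suc a b) (cong suc a+b) ,
  ≤-trans (≤-reflexive (*-suc (suc s) b)) (+-mono-≤ (≰⇒> r≰s) b≤) ,
  (begin
    satProb s (r zero) * ∏ (satProb s ∘ r ∘ suc) ≤⟨ *-mono-≤ (subst (satProb s (r zero) ≤_) eq (satProb≤ s (r zero))) ∏≤ ⟩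
    suc k * (k ^ a * suc k ^ b)                  ≡⟨ solve 3 (λ x y z → x :* (y :* z) := y :* (x :* z)) refl (suc k) (k ^ a) (suc k ^ b) ⟩
    k ^ a * (suc k * suc k ^ b)                  ∎)
  where open ≤-Reasoning

-- Power estimates and the probability that all clauses hold.

bernoulli : ∀ k j → k ^ suc j + suc j * k ^ j ≤ suc k ^ suc j
bernoulli k zero    = ≤-reflexive (solve 1 (λ k → k :* con 1 :+ con 1 := (con 1 :+ k) :* con 1) refl k)
bernoulli k (suc j) = begin
  k * (k * x) + suc (suc j) * (k * x)                   ≤⟨ m≤m+n _ (suc j * x) ⟩
  k * (k * x) + suc (suc j) * (k * x) + suc j * x       ≡⟨ solve 3 (λ k j x → k :* (k :* x) :+ (con 2 :+ j) :* (k :* x) :+ (con 1 :+ j) :* x := (con 1 :+ k) :* (k :* x :+ (con 1 :+ j) :* x)) refl k j x ⟩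
  suc k * (k * x + suc j * x)                           ≤⟨ *-monoʳ-≤ (suc k) (bernoulli k j) ⟩
  suc k * suc k ^ suc j                                 ∎
  where
  open ≤-Reasoning
  x = k ^ j

-- This is (1 - 1/K)^K ≤ 1/2 for K = `suc k`: the second binomial term `suc k * k ^ k` is at least
-- `k ^ suc k`.
^-halving : ∀ k → 2 * k ^ suc k ≤ suc k ^ suc k
^-halving k = ≤-trans (+-monoʳ-≤ (k ^ suc k) (≤-trans (≤-reflexive (+-identityʳ _)) (*-monoˡ-≤ (k ^ k) (n≤1+n k))))
                      (bernoulli k k)

*-^-distrib : ∀ a b n → (a * b) ^ n ≡ a ^ n * b ^ n
*-^-distrib a b zero    = refl
*-^-distrib a b (suc n) = trans (cong (a * b *_) (*-^-distrib a b n))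
  (solve 4 (λ a b c d → (a :* b) :* (c :* d) := (a :* c) :* (b :* d)) refl a b (a ^ n) (b ^ n))

-- Each block of `suc k` factors gains a factor 2 by `^-halving`, and `a` factors contain `L`
-- blocks; the `e` left over are compared termwise.
2^L*k^a≤ : ∀ k L a → suc k * L ≤ a → 2 ^ L * k ^ a ≤ suc k ^ a
2^L*k^a≤ k L a KL≤a with e , refl ← m≤n⇒∃[o]m+o≡n KL≤a = begin
  2 ^ L * k ^ (suc k * L + e)                ≡⟨ cong (2 ^ L *_) (trans (^-distribˡ-+-* k (suc k * L) e) (cong (_* k ^ e) (sym (^-*-assoc k (suc k) L)))) ⟩
  2 ^ L * ((k ^ suc k) ^ L * k ^ e)          ≡⟨ *-assoc (2 ^ L) _ _ ⟨
  2 ^ L * (k ^ suc k) ^ L * k ^ e            ≡⟨ cong (_* k ^ e) (*-^-distrib 2 (k ^ suc k) L) ⟨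
  (2 * k ^ suc k) ^ L * k ^ e                ≤⟨ *-mono-≤ (^-monoˡ-≤ L (^-halving k)) (^-monoˡ-≤ e (n≤1+n k)) ⟩
  (suc k ^ suc k) ^ L * suc k ^ e            ≡⟨ cong (_* suc k ^ e) (^-*-assoc (suc k) (suc k) L) ⟩
  suc k ^ (suc k * L) * suc k ^ e            ≡⟨ ^-distribˡ-+-* (suc k) (suc k * L) e ⟨
  suc k ^ (suc k * L + e)                    ∎
  where open ≤-Reasoning

-- The average clause length is at most `suc s / 2`, so at least half of the clauses have at most
-- `s` bits. These all hold with probability at most (1 - 2⁻ˢ)^(m/2), and `m / 2` covers `L` blocks
-- of `2 ^ s` clauses, each block halving the probability.
∑ᵇ-satisfied-all : ∀ {m N} s L (ls : Vec (Maybe (Fin m)) N) → 2 * N ≤ suc s * m → 2 * (2 ^ s * L) ≤ m →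
                   ∑ᵇ N (satisfied (const true) ls) * 2 ^ L ≤ 2 ^ N
∑ᵇ-satisfied-all {m} {N} s L ls N≤ L≤ with k , e ← m≤n⇒∃[o]m+o≡n (m^n>0 2 s) with eq ← sym e
  with a , b , refl , b≤ , ∏≤ ← ∏-satProb s eq (occurrences ls) =
  *-cancelʳ-≤ (S * 2 ^ L) (2 ^ N) (suc k ^ (a + b)) {{m^n≢0 (suc k) (a + b)}} (begin
    S * 2 ^ L * suc k ^ (a + b)             ≡⟨ solve 3 (λ x y z → x :* y :* z := x :* z :* y) refl S (2 ^ L) (suc k ^ (a + b)) ⟩
    S * suc k ^ (a + b) * 2 ^ L             ≡⟨ cong (λ K → S * K ^ (a + b) * 2 ^ L) eq ⟨
    S * (2 ^ s) ^ (a + b) * 2 ^ L           ≤⟨ *-monoˡ-≤ (2 ^ L) (∑ᵇ-satisfied s (const true) ls) ⟩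
    2 ^ N * ∏ (satProb s ∘ occurrences ls) * 2 ^ L ≤⟨ *-monoˡ-≤ (2 ^ L) (*-monoʳ-≤ (2 ^ N) ∏≤) ⟩
    2 ^ N * (k ^ a * suc k ^ b) * 2 ^ L     ≡⟨ solve 4 (λ x y z w → x :* (y :* z) :* w := x :* ((w :* y) :* z)) refl (2 ^ N) (k ^ a) (suc k ^ b) (2 ^ L) ⟩
    2 ^ N * (2 ^ L * k ^ a * suc k ^ b)     ≤⟨ *-monoʳ-≤ (2 ^ N) (*-monoˡ-≤ (suc k ^ b) (2^L*k^a≤ k L a KL≤a)) ⟩
    2 ^ N * (suc k ^ a * suc k ^ b)         ≡⟨ cong (2 ^ N *_) (^-distribˡ-+-* (suc k) a b) ⟨
    2 ^ N * suc k ^ (a + b)                 ∎)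
  where
  open ≤-Reasoning
  S = ∑ᵇ N (satisfied (const true) ls)
  2b≤a+b : 2 * b ≤ a + b
  2b≤a+b = *-cancelˡ-≤ (suc s) (begin
    suc s * (2 * b)        ≡⟨ solve 2 (λ x y → x :* (con 2 :* y) := con 2 :* (x :* y)) refl (suc s) b ⟩
    2 * (suc s * b)        ≤⟨ *-monoʳ-≤ 2 (≤-trans b≤ (∑-occurrences ls)) ⟩
    2 * N                  ≤⟨ N≤ ⟩
    suc s * (a + b)        ∎)
  b≤a : b ≤ a
  b≤a = +-cancelʳ-≤ b b a (≤-trans (≤-reflexive (cong (λ o → b + o) (sym (+-identityʳ b)))) 2b≤a+b)
  KL≤a : suc k * L ≤ a
  KL≤a = *-cancelˡ-≤ 2 (begin
    2 * (suc k * L)  ≡⟨ cong (λ K → 2 * (K * L)) eq ⟨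
    2 * (2 ^ s * L)  ≤⟨ L≤ ⟩
    a + b            ≤⟨ +-monoʳ-≤ a b≤a ⟩
    a + a            ≡⟨ cong (λ o → a + o) (+-identityʳ a) ⟨
    2 * a            ∎)

-- Listing all assignments of vertices to branch sets.

allVec : ∀ {A : Set} → List A → ∀ n → List (Vec A n)
allVec as zero    = [] ∷ []
allVec as (suc n) = cartesianProductWith _∷_ as (allVec as n)

length-cartesianProductWith : ∀ {A B C : Set} (f : A → B → C) as bs →
                              length (cartesianProductWith f as bs) ≡ length as * length bs
length-cartesianProductWith f []       bs = refl
length-cartesianProductWith f (a ∷ as) bs =
  trans (length-++ (List.map (f a) bs)) (cong₂ _+_ (length-map (f a) bs) (length-cartesianProductWith f as bs))

length-allVec : ∀ {A : Set} (as : List A) n → length (allVec as n) ≡ length as ^ n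
length-allVec as zero    = refl
length-allVec as (suc n) =
  trans (length-cartesianProductWith _∷_ as (allVec as n)) (cong (length as *_) (length-allVec as n))

∈-allVec : ∀ {A : Set} {as : List A} → (∀ a → a ∈ as) → ∀ {n} (v : Vec A n) → v ∈ allVec as n
∈-allVec full []      = here refl
∈-allVec full (a ∷ v) = ∈-cartesianProductWith⁺ _∷_ (full a) (∈-allVec full v)

allMaybeFin : ∀ P → List (Maybe (Fin P))
allMaybeFin P = nothing ∷ List.map just (allFin P)

∈-allMaybeFin : ∀ {P} (h : Maybe (Fin P)) → h ∈ allMaybeFin P
∈-allMaybeFin nothing  = here refl
∈-allMaybeFin (just h) = there (∈-map⁺ just (∈-allFin h))

length-allMaybeFin : ∀ P → length (allMaybeFin P) ≡ suc P
length-allMaybeFin P = cong suc (trans (length-map just (allFin P)) (length-tabulate {n = P} _))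

-- Graphs read off from bits.

<ᵇ-irrefl : ∀ n → (n <ᵇ n) ≡ false
<ᵇ-irrefl zero    = refl
<ᵇ-irrefl (suc n) = <ᵇ-irrefl n

module _ {n} (f : Fin n → Fin n → Bool) where

  -- Each potential edge is decided by the single value `f u v` with `u <ᶠ v`, so different edges
  -- use different bits.
  bitGraph : Graph n
  bitGraph = record
    { adj    = λ u v → (u <ᶠ v ∧ f u v) ∨ (v <ᶠ u ∧ f v u)
    ; sym    = λ u v → ∨-comm (u <ᶠ v ∧ f u v) _
    ; irrefl = λ v → irr v }
    where
    irr : ∀ v → (v <ᶠ v ∧ f v v) ∨ (v <ᶠ v ∧ f v v) ≡ false
    irr v rewrite <ᵇ-irrefl (toℕ v) = refl

  bitGraph-adj : ∀ {u v} → adj bitGraph u v ≡ true →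
                 ((u <ᶠ v) ≡ true × f u v ≡ true) ⊎ ((v <ᶠ u) ≡ true × f v u ≡ true)
  bitGraph-adj {u} {v} uv with u <ᶠ v | f u v | v <ᶠ u | f v u
  ... | true  | true  | _    | _    = inj₁ (refl , refl)
  ... | true  | false | true | true = inj₂ (refl , refl)
  ... | false | _     | true | true = inj₂ (refl , refl)

∑∑< : ∀ n → 2 * (∑ λ (u : Fin n) → ∑ λ (v : Fin n) → 𝟙 (u <ᶠ v)) + n ≡ n * n
∑∑< zero    = refl
∑∑< (suc n) = begin
  2 * ((∑ λ (v : Fin n) → 1) + T) + suc n   ≡⟨ cong (λ k → 2 * (k + T) + suc n) (∑1 n) ⟩
  2 * (n + T) + suc n          ≡⟨ solve 2 (λ n T → con 2 :* (n :+ T) :+ (con 1 :+ n) := (con 2 :* T :+ n) :+ (con 1 :+ n :+ n)) refl n T ⟩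
  (2 * T + n) + (1 + n + n)    ≡⟨ cong (_+ (1 + n + n)) (∑∑< n) ⟩
  n * n + (1 + n + n)          ≡⟨ solve 1 (λ n → n :* n :+ (con 1 :+ n :+ n) := (con 1 :+ n) :* (con 1 :+ n)) refl n ⟩
  suc n * suc n                ∎
  where
  open ≡-Reasoning
  T = ∑ λ (u : Fin n) → ∑ λ (v : Fin n) → 𝟙 (u <ᶠ v)
  ∑1 : ∀ n → (∑ λ (v : Fin n) → 1) ≡ n
  ∑1 zero    = refl
  ∑1 (suc n) = cong suc (∑1 n)

-- Every pair `u <ᶠ v` is an edge of one of the two graphs. The factor 2 and the summand `n` express
-- the number of pairs without subtraction.
bitGraph-edgeCount : ∀ {n} (f : Fin n → Fin n → Bool) →
  n * n ≤ 2 * (edgeCount (bitGraph f) + edgeCount (bitGraph (λ u v → not (f u v)))) + n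
bitGraph-edgeCount {n} f rewrite edgeCount-∑ (bitGraph f) | edgeCount-∑ (bitGraph (λ u v → not (f u v))) = begin
  n * n                                                  ≡⟨ ∑∑< n ⟨
  2 * (∑ λ (u : Fin n) → ∑ λ (v : Fin n) → 𝟙 (u <ᶠ v)) + n
    ≤⟨ +-monoˡ-≤ n (*-monoʳ-≤ 2 (∑-mono λ u → ∑-mono λ v → split u v)) ⟩
  2 * (∑ λ u → ∑ λ v → e u v + e′ u v) + n
    ≡⟨ cong (λ k → 2 * k + n) (trans (∑-cong λ u → ∑-+ (e u) (e′ u)) (∑-+ (λ u → ∑ (e u)) (λ u → ∑ (e′ u)))) ⟩
  2 * ((∑ λ u → ∑ (e u)) + (∑ λ u → ∑ (e′ u))) + n      ∎
  where
  open ≤-Reasoning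
  e e′ : Fin n → Fin n → ℕ
  e u v = 𝟙 (u <ᶠ v ∧ adj (bitGraph f) u v)
  e′ u v = 𝟙 (u <ᶠ v ∧ adj (bitGraph (λ u v → not (f u v))) u v)
  split : ∀ u v → 𝟙 (u <ᶠ v) ≤ e u v + e′ u v
  split u v with u <ᶠ v | f u v
  ... | true  | true  = s≤s z≤n
  ... | true  | false = m≤n+m 1 _
  ... | false | _     = z≤n

-- A dense graph without a large complete minor.

module _ {Q : ℕ} where

  -- Both orders give the same clause, since the smaller end of an edge may lie on either side.
  crossing : Fin Q ⊎ Fin Q → Fin Q ⊎ Fin Q → Maybe (Fin (Q * Q))
  crossing (inj₁ i) (inj₂ j) = just (combine i j)
  crossing (inj₂ j) (inj₁ i) = just (combine i j)
  crossing _        _        = nothing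

  clause : Maybe (Fin (Q + Q)) → Maybe (Fin (Q + Q)) → Maybe (Fin (Q * Q))
  clause (just h) (just h′) = crossing (splitAt Q h) (splitAt Q h′)
  clause _        _         = nothing

  module _ (n : ℕ) where

    -- There is one bit for every ordered pair, to match `combine`; those without `u <ᶠ v` belong to
    -- no clause.
    label : Vec (Maybe (Fin (Q + Q))) n → Fin n × Fin n → Maybe (Fin (Q * Q))
    label β (u , v) = if u <ᶠ v then clause (lookup β u) (lookup β v) else nothing

    labels : Vec (Maybe (Fin (Q + Q))) n → Vec (Maybe (Fin (Q * Q))) (n * n)
    labels β = Vec.tabulate (label β ∘ remQuot n)

    bits : Vec Bool (n * n) → Fin n → Fin n → Bool
    bits x u v = lookup x (combine u v)

    -- The model has an edge between the branch sets `i ↑ˡ Q` and `Q ↑ʳ j`; its bit is true and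
    -- carries the label `combine i j`.
    minor⇒satisfied : ∀ x (M : HasKMinor (Q + Q) (bitGraph (bits x))) →
                      0 < satisfied (const true) (labels (Vec.tabulate (MinorModel.β M))) x
    minor⇒satisfied x M = satisfied>0 (const true) (labels β′) x hit
      where
      open MinorModel M
      β′ = Vec.tabulate β
      label≡ : ∀ {u v h h′ c} → (u <ᶠ v) ≡ true → β u ≡ just h → β v ≡ just h′ →
               crossing (splitAt Q h) (splitAt Q h′) ≡ just c →
               lookup (labels β′) (combine u v) ≡ just c
      label≡ {u} {v} {c = c} u<v bu bv eq =
        trans (lookup∘tabulate (label β′ ∘ remQuot n) (combine u v))
              (trans (cong (label β′) (remQuot-combine u v)) here≡)
        where
        here≡ : label β′ (u , v) ≡ just c
        here≡ rewrite u<v | lookup∘tabulate β u | lookup∘tabulate β v | bu | bv = eq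
      ↑≢↑ : ∀ i j → i ↑ˡ Q ≢ Q ↑ʳ j
      ↑≢↑ i j eq with trans (sym (splitAt-↑ˡ Q i Q)) (trans (cong (splitAt Q) eq) (splitAt-↑ʳ Q Q j))
      ... | ()
      hit : ∀ c → true ≡ true → ∃ λ e → lookup (labels β′) e ≡ just c × lookup x e ≡ true
      hit c _ with combine-surjective {Q} {Q} c
      ... | i , j , refl with edges (i ↑ˡ Q) (Q ↑ʳ j) (complete-adj (↑≢↑ i j))
      ...   | u , v , bu , bv , uv with bitGraph-adj (bits x) {u} {v} uv
      ...     | inj₁ (u<v , xuv) = combine u v ,
                  label≡ u<v bu bv (cong₂ crossing (splitAt-↑ˡ Q i Q) (splitAt-↑ʳ Q Q j)) , xuv
      ...     | inj₂ (v<u , xvu) = combine v u ,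
                  label≡ v<u bv bu (cong₂ crossing (splitAt-↑ʳ Q Q j) (splitAt-↑ˡ Q i Q)) , xvu

    bits-not : ∀ x u v → bits (Vec.map not x) u v ≡ not (bits x u v)
    bits-not x u v = lookup-map (combine u v) not x

  -- Found as one of a random graph and its complement: both are minor-free, and one of them is dense.
  denseMinorFree : ∀ n s L → 2 * (n * n) ≤ suc s * (Q * Q) → 2 * (2 ^ s * L) ≤ Q * Q →
    suc (Q + Q) ^ n * 4 ≤ 2 ^ L →
    ∃ λ (D : Graph n) → ¬ HasKMinor (Q + Q) D × n * n ≤ 4 * edgeCount D + n
  denseMinorFree n s L N≤ L≤ count≤ with ∑ᵇ<2^⇒zero (n * n) total total<
    where
    open ≤-Reasoning
    N = n * n
    βs = allVec (allMaybeFin (Q + Q)) n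
    bad : Vec (Maybe (Fin (Q + Q))) n → Vec Bool N → ℕ
    bad β x = satisfied (const true) (labels n β) x + satisfied (const true) (labels n β) (Vec.map not x)
    total : Vec Bool N → ℕ
    total x = ∑ˡ (λ β → bad β x) βs
    bad≤ : ∀ β → ∑ᵇ N (bad β) * 2 ^ L ≤ 2 * 2 ^ N
    bad≤ β = begin
      ∑ᵇ N (bad β) * 2 ^ L ≡⟨ cong (_* 2 ^ L) (trans (∑ᵇ-+ N sat (sat ∘ Vec.map not)) (cong (λ o → ∑ᵇ N sat + o) (∑ᵇ-not N sat))) ⟩
      (∑ᵇ N sat + ∑ᵇ N sat) * 2 ^ L ≡⟨ solve 2 (λ a b → (a :+ a) :* b := con 2 :* (a :* b)) refl (∑ᵇ N sat) (2 ^ L) ⟩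
      2 * (∑ᵇ N sat * 2 ^ L) ≤⟨ *-monoʳ-≤ 2 (∑ᵇ-satisfied-all s L (labels n β) N≤ L≤) ⟩
      2 * 2 ^ N ∎
      where sat = satisfied (const true) (labels n β)
    S = ∑ᵇ N total
    -- The 4 in `count≤` splits into 2 for the graph and its complement, and 2 to make the average
    -- of `total` at most 1/2, hence strictly below 1.
    2S≤ : 2 * S ≤ 2 ^ N
    2S≤ = *-cancelʳ-≤ (2 * S) (2 ^ N) (2 ^ L) {{m^n≢0 2 L}} (begin
      2 * S * 2 ^ L                    ≡⟨ *-assoc 2 S (2 ^ L) ⟩
      2 * (S * 2 ^ L)                  ≤⟨ *-monoʳ-≤ 2 (union-bound bad bad≤ βs) ⟩
      2 * (length βs * (2 * 2 ^ N))    ≡⟨ solve 2 (λ a b → con 2 :* (a :* (con 2 :* b)) := b :* (a :* con 4)) refl (length βs) (2 ^ N) ⟩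
      2 ^ N * (length βs * 4)          ≡⟨ cong (λ k → 2 ^ N * (k * 4)) (trans (length-allVec (allMaybeFin (Q + Q)) n) (cong (_^ n) (length-allMaybeFin (Q + Q)))) ⟩
      2 ^ N * (suc (Q + Q) ^ n * 4)    ≤⟨ *-monoʳ-≤ (2 ^ N) count≤ ⟩
      2 ^ N * 2 ^ L                    ∎)
    total< : S < 2 ^ N
    total< = *-cancelˡ-< 2 S (2 ^ N) (≤-<-trans 2S≤ (m<m+n (2 ^ N) (≤-trans (m^n>0 2 N) (m≤m+n _ 0))))
  ... | x , total≡0 = choose (≤-total e₁ e₀)
    where
    G₀ G₁ : Graph n
    G₀ = bitGraph (bits n x)
    G₁ = bitGraph (bits n (Vec.map not x))
    e₀ e₁ : ℕ
    e₀ = edgeCount G₀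
    e₁ = edgeCount G₁
    sat≡0 : ∀ β → satisfied (const true) (labels n β) x ≡ 0 ×
                  satisfied (const true) (labels n β) (Vec.map not x) ≡ 0
    sat≡0 β = m+n≡0⇒m≡0 (sat β x) eq , m+n≡0⇒n≡0 (sat β x) eq
      where
      sat : Vec (Maybe (Fin (Q + Q))) n → Vec Bool (n * n) → ℕ
      sat β = satisfied (const true) (labels n β)
      eq : sat β x + sat β (Vec.map not x) ≡ 0
      eq = ∑ˡ≡0 {f = λ β → sat β x + sat β (Vec.map not x)} total≡0 (∈-allVec ∈-allMaybeFin β)
    e≥ : n * n ≤ 2 * (e₀ + e₁) + n
    e≥ = ≤-trans (bitGraph-edgeCount (bits n x)) (≤-reflexive (cong (λ k → 2 * (e₀ + k) + n) same))
      where
      same : edgeCount (bitGraph (λ u v → not (bits n x u v))) ≡ e₁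
      same = trans (edgeCount-∑ (bitGraph (λ u v → not (bits n x u v)))) (trans
        (∑-cong λ u → ∑-cong λ v → cong (λ b → 𝟙 (u <ᶠ v ∧ b))
          (cong₂ (λ a b → (u <ᶠ v ∧ a) ∨ (v <ᶠ u ∧ b)) (sym (bits-not n x u v)) (sym (bits-not n x v u))))
        (sym (edgeCount-∑ G₁)))
    4* : ∀ {a b e} → a ≤ e → b ≤ e → 2 * (a + b) + n ≤ 4 * e + n
    4* {e = e} a≤e b≤e = +-monoˡ-≤ n (≤-trans (*-monoʳ-≤ 2 (+-mono-≤ a≤e b≤e))
                           (≤-reflexive (solve 1 (λ e → con 2 :* (e :+ e) := con 4 :* e) refl e)))
    choose : e₁ ≤ e₀ ⊎ e₀ ≤ e₁ → ∃ λ (D : Graph n) → ¬ HasKMinor (Q + Q) D × n * n ≤ 4 * edgeCount D + n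
    choose (inj₁ e₁≤e₀) = G₀ , (λ M → n>0⇒n≢0 (minor⇒satisfied n x M) (proj₁ (sat≡0 (Vec.tabulate (MinorModel.β M))))) , ≤-trans e≥ (4* ≤-refl e₁≤e₀)
    choose (inj₂ e₀≤e₁) = G₁ , (λ M → n>0⇒n≢0 (minor⇒satisfied n (Vec.map not x) M) (proj₂ (sat≡0 (Vec.tabulate (MinorModel.β M))))) , ≤-trans e≥ (4* e₀≤e₁ ≤-refl)

-- Choice of the parameters.

n<2^n : ∀ n → n < 2 ^ n
n<2^n zero    = s≤s z≤n
n<2^n (suc n) = ≤-trans (s≤s (n<2^n n)) (+-mono-≤ (m^n>0 2 n) (m≤m+n (2 ^ n) 0))

2*n≤2^n : ∀ n → 2 * suc n ≤ 2 ^ suc n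
2*n≤2^n n = *-monoʳ-≤ 2 (n<2^n n)

-- With `Q = 2 ^ q`, each vertex has 2Q + 1 ≤ 4Q = 2^(2+q) choices. This fixes the exponent `L`,
-- whose summand 2 pays for the factor 4.
branchings-few : ∀ q n → suc (2 ^ q + 2 ^ q) ^ n * 4 ≤ 2 ^ (2 + (2 + q) * n)
branchings-few q n = begin
  suc (Q + Q) ^ n * 4          ≤⟨ *-monoˡ-≤ 4 (^-monoˡ-≤ n 1+2Q≤) ⟩
  (2 ^ (2 + q)) ^ n * 4        ≡⟨ cong (_* 4) (^-*-assoc 2 (2 + q) n) ⟩
  2 ^ ((2 + q) * n) * 4        ≡⟨ *-comm (2 ^ ((2 + q) * n)) 4 ⟩
  4 * 2 ^ ((2 + q) * n)        ≡⟨ ^-distribˡ-+-* 2 2 ((2 + q) * n) ⟨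
  2 ^ (2 + (2 + q) * n)        ∎
  where
  open ≤-Reasoning
  Q = 2 ^ q
  1+2Q≤ : suc (Q + Q) ≤ 2 ^ (2 + q)
  1+2Q≤ = begin
    1 + (Q + Q)        ≤⟨ +-monoˡ-≤ (Q + Q) (≤-trans (m^n>0 2 q) (m≤m+n Q Q)) ⟩
    Q + Q + (Q + Q)    ≡⟨ solve 1 (λ Q → Q :+ Q :+ (Q :+ Q) := con 2 :* (con 2 :* Q)) refl Q ⟩
    2 * (2 * Q)        ∎

-- The dense graph without a K_{2Q} minor gets c Q vertices and at least d Q² edges;
-- s bounds the length of at least half of the Q² clauses.
module _ (c d s : ℕ) (2≤c : 2 ≤ c) (s-large : 2 * (c * c) ≤ suc s) (d-small : 4 * d + c ≤ c * c) where

  exponent : ∀ x → ∃ λ q → x ≤ q × 2 * (2 ^ s * (2 + (2 + q) * (c * 2 ^ q))) ≤ 2 ^ q * 2 ^ q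
  exponent x = q , x≤q , (begin
    2 * (2 ^ s * (2 + (2 + q) * (c * Q)))   ≤⟨ *-monoʳ-≤ 2 (*-monoʳ-≤ (2 ^ s) (+-monoˡ-≤ ((2 + q) * (c * Q)) 2≤cQ)) ⟩
    2 * (2 ^ s * ((3 + q) * (c * Q)))       ≡⟨ solve 4 (λ a b c Q → con 2 :* (a :* (b :* (c :* Q))) := (con 2 :* (a :* c)) :* b :* Q) refl (2 ^ s) (3 + q) c Q ⟩
    2 * (2 ^ s * c) * (3 + q) * Q           ≤⟨ *-monoˡ-≤ Q (*-mono-≤ (*-monoʳ-≤ 2 (*-monoʳ-≤ (2 ^ s) (<⇒≤ (n<2^n c)))) 3+q≤) ⟩
    2 * (2 ^ s * 2 ^ c) * 2 ^ r * Q         ≡⟨ cong (λ k → 2 * k * 2 ^ r * Q) (^-distribˡ-+-* 2 s c) ⟨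
    2 ^ suc (s + c) * 2 ^ r * Q             ≡⟨ cong (_* Q) (^-distribˡ-+-* 2 (suc (s + c)) r) ⟨
    Q * Q                                   ∎)
    where
    open ≤-Reasoning
    -- `Q` is `2 ^ suc (s + c)`, absorbing `2 * (2 ^ s * c)`, times `2 ^ r`, absorbing `3 + q`. The
    -- part `4 + (s + c)` of `r` gives `3 + q ≤ 2 * r`, and the part `x` gives `x ≤ q`.
    r = suc (3 + (s + c) + x)
    q = suc (s + c) + r
    Q = 2 ^ q
    x≤q : x ≤ q
    x≤q = ≤-trans (m≤n+m x (4 + (s + c))) (m≤n+m r (suc (s + c)))
    2≤cQ : 2 ≤ c * Q
    2≤cQ = *-mono-≤ 2≤c (m^n>0 2 q)
    3+q≤ : 3 + q ≤ 2 ^ r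
    3+q≤ = begin
      4 + (s + c) + r  ≤⟨ +-monoˡ-≤ r (m≤m+n (4 + (s + c)) x) ⟩
      r + r            ≡⟨ cong (λ o → r + o) (+-identityʳ r) ⟨
      2 * r            ≤⟨ 2*n≤2^n (3 + (s + c) + x) ⟩
      2 ^ r            ∎

  clauses-large : ∀ Q → 2 * (c * Q * (c * Q)) ≤ suc s * (Q * Q)
  clauses-large Q = begin
    2 * (c * Q * (c * Q))    ≡⟨ solve 2 (λ c Q → con 2 :* (c :* Q :* (c :* Q)) := con 2 :* (c :* c) :* (Q :* Q)) refl c Q ⟩
    2 * (c * c) * (Q * Q)    ≤⟨ *-monoˡ-≤ (Q * Q) s-large ⟩
    suc s * (Q * Q)          ∎
    where open ≤-Reasoning

  -- The linear term `c * Q` is at most `c * (Q * Q)`, which `d-small` leaves room for.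
  edges-many : ∀ {Q e} → 1 ≤ Q → c * Q * (c * Q) ≤ 4 * e + c * Q → d * (Q * Q) ≤ e
  edges-many {Q} {e} 1≤Q n²≤ = *-cancelˡ-≤ 4 (+-cancelʳ-≤ (c * Q) (4 * (d * (Q * Q))) (4 * e) (begin
    4 * (d * (Q * Q)) + c * Q          ≤⟨ +-monoʳ-≤ (4 * (d * (Q * Q))) (*-monoʳ-≤ c (≤-trans (≤-reflexive (sym (*-identityʳ Q))) (*-monoʳ-≤ Q 1≤Q))) ⟩
    4 * (d * (Q * Q)) + c * (Q * Q)    ≡⟨ solve 3 (λ c d x → con 4 :* (d :* x) :+ c :* x := (con 4 :* d :+ c) :* x) refl c d (Q * Q) ⟩
    (4 * d + c) * (Q * Q)              ≤⟨ *-monoˡ-≤ (Q * Q) d-small ⟩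
    c * c * (Q * Q)                    ≡⟨ [m*n]*[o*p]≡[m*o]*[n*p] c Q c Q ⟨
    c * Q * (c * Q)                    ≤⟨ n²≤ ⟩
    4 * e + c * Q                      ∎))
    where open ≤-Reasoning

  denseFamily : ∀ x → ∃ λ Q → x ≤ Q × ∃ λ (D : Graph (c * Q)) →
                ¬ HasKMinor (Q + Q) D × d * (Q * Q) ≤ edgeCount D
  denseFamily x =
    let q , x≤q , L≤ = exponent x
        D , ¬M , n²≤ = denseMinorFree {2 ^ q} (c * 2 ^ q) s (2 + (2 + q) * (c * 2 ^ q))
                         (clauses-large (2 ^ q)) L≤ (branchings-few q (c * 2 ^ q))
    in 2 ^ q , ≤-trans x≤q (<⇒≤ (n<2^n q)) , D , ¬M , edges-many (m^n>0 2 q) n²≤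

-- From the hypothesis to Hadwiger's conjecture.

-- A crude bound suffices: the binomial term is dropped and the final 1 is absorbed into `2 * M`.
maderBound≤ : ∀ P M c → 1 ≤ M → ((+ P -ℤ + 2) *ℤ + M -ℤ + c) +ℤ + 1 ≤ℤ + (P * M)
maderBound≤ P M c 1≤M = begin
  ((+ P -ℤ + 2) *ℤ + M -ℤ + c) +ℤ + 1   ≤⟨ ℤ.+-monoˡ-≤ (+ 1) (ℤ.i-j≤i ((+ P -ℤ + 2) *ℤ + M) (+ c)) ⟩
  (+ P -ℤ + 2) *ℤ + M +ℤ + 1            ≤⟨ ℤ.+-monoʳ-≤ ((+ P -ℤ + 2) *ℤ + M) (+≤+ (≤-trans 1≤M (m≤m+n M (M + 0)))) ⟩
  (+ P -ℤ + 2) *ℤ + M +ℤ + (2 * M)      ≡⟨ cong ((+ P -ℤ + 2) *ℤ + M +ℤ_) (ℤ.pos-* 2 M) ⟩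
  (+ P -ℤ + 2) *ℤ + M +ℤ + 2 *ℤ + M     ≡⟨ ℤ.*-distribʳ-+ (+ M) (+ P -ℤ + 2) (+ 2) ⟨
  (+ P -ℤ + 2 +ℤ + 2) *ℤ + M            ≡⟨ cong (_*ℤ + M) (trans (ℤ.+-assoc (+ P) (ℤ.- + 2) (+ 2)) (ℤ.+-identityʳ (+ P))) ⟩
  + P *ℤ + M                            ≡⟨ ℤ.pos-* P M ⟨
  + (P * M)                             ∎
  where open ℤ.≤-Reasoning

Colorable-mono : ∀ {n c d} {G : Graph n} → c ≤ d → Colorable c G → Colorable d G
Colorable-mono c≤d (f , proper) =
  (λ v → inject≤ (f v) c≤d) , λ u v uv eq → proper u v uv (inject≤-injective c≤d c≤d (f u) (f v) eq)

MaderOrColorable : Set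
MaderOrColorable = ∀ (p : ℕ) → 1 ≤ p → ∀ (n : ℕ) (G : Graph n) →
    (((+ p -ℤ + 2) *ℤ + n) -ℤ + ((p ∸ 1) C 2)) +ℤ + 1 ≤ℤ + edgeCount G →
    HasKMinor p G ⊎ Colorable (p ∸ 1) G

module _ (mader : MaderOrColorable) where

  -- With t = 2Q - (p + 1) cones over `G`, the union with `D` has t + n + m ≤ 3Q + m vertices, so
  -- the edges of `D` alone reach the bound.
  hadwiger-from : ∀ {p n Q m} (G : Graph n) (D : Graph m) → suc p + n ≤ Q → 1 ≤ m →
    ¬ HasKMinor (Q + Q) D → (Q + Q) * (Q + Q + Q + m) ≤ edgeCount D →
    ¬ HasKMinor (suc p) G → Colorable p G
  hadwiger-from {p} {n} {Q} {m} G D p+n≤Q 1≤m ¬MD e≥ ¬MG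
    with t , eq ← m≤n⇒∃[o]m+o≡n {suc p} {Q + Q} (≤-trans (m≤m+n (suc p) n) (≤-trans p+n≤Q (m≤m+n Q Q)))
    with mader (Q + Q) (≤-trans (s≤s z≤n) (≤-reflexive eq)) (t + n + m) (disjointUnion (cones t G) D)
      (ℤ.≤-trans (maderBound≤ (Q + Q) (t + n + m) ((Q + Q ∸ 1) C 2) (≤-trans 1≤m (m≤n+m m (t + n))))
        (+≤+ (≤-trans (*-monoʳ-≤ (Q + Q) (+-monoˡ-≤ m (+-mono-≤ (≤-trans (m≤n+m t (suc p)) (≤-reflexive eq))
                                                                (≤-trans (m≤n+m n (suc p)) p+n≤Q))))
                      (≤-trans e≥ (edgeCount-disjointUnionʳ (cones t G) D)))))
  -- Here 2Q - 1 = t + p: the cones use up `t` colours and leave `p` for `G`.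
  ... | inj₂ col =
    cones-colorable⁻ t (subst (λ k → Colorable k (cones t G)) (trans (cong (_∸ 1) (sym eq)) (+-comm p t))
      (disjointUnion-colorableˡ (cones t G) D col))
  ... | inj₁ M with disjointUnion-minor⁻ (cones t G) D (subst Fin eq zero) M
  ...   | inj₁ M′ = contradiction
    (cones-minor⁻ t (subst (λ k → HasKMinor k (cones t G)) (trans (sym eq) (+-comm (suc p) t)) M′)) ¬MG
  ...   | inj₂ M′ = contradiction M′ ¬MD

  -- For `D` on cQ vertices the edges required are 2Q(3Q + cQ), and `d-large` bounds this by dQ².
  hadwiger : ∀ c d s → 2 ≤ c → 2 * (c * c) ≤ suc s → 4 * d + c ≤ c * c → 2 * (3 + c) ≤ d →
             ∀ {p n} (G : Graph n) → ¬ HasKMinor (suc p) G → Colorable p G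
  hadwiger c d s 2≤c s-large d-small d-large {p} {n} G ¬M =
    let Q , x≤Q , D , ¬MD , e≥ = denseFamily c d s 2≤c s-large d-small (suc p + n)
    in hadwiger-from G D x≤Q (*-mono-≤ (<⇒≤ 2≤c) (≤-trans (s≤s z≤n) x≤Q)) ¬MD (≤-trans (size≤ Q) e≥) ¬M
    where
    open ≤-Reasoning
    size≤ : ∀ Q → (Q + Q) * (Q + Q + Q + c * Q) ≤ d * (Q * Q)
    size≤ Q = begin
      (Q + Q) * (Q + Q + Q + c * Q)  ≡⟨ solve 2 (λ c Q → (Q :+ Q) :* (Q :+ Q :+ Q :+ c :* Q) := con 2 :* (con 3 :+ c) :* (Q :* Q)) refl c Q ⟩
      2 * (3 + c) * (Q * Q)          ≤⟨ *-monoˡ-≤ (Q * Q) d-large ⟩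
      d * (Q * Q)                    ∎

theorem5p2 : (∀ (p : ℕ) → 1 ≤ p → ∀ (n : ℕ) (G : Graph n) →
    (((+ p -ℤ + 2) *ℤ + n) -ℤ + ((p ∸ 1) C 2)) +ℤ + 1 ≤ℤ + edgeCount G →
    HasKMinor p G ⊎ Colorable (p ∸ 1) G) →
    ∀ (p : ℕ) → 5 ≤ p → ∀ (n : ℕ) (G : Graph n) →
    ¬ HasKMinor p G → Colorable (2 * p ∸ 6) G
-- Taking d = 2(3 + c), `d-small` reads 8(3 + c) + c ≤ c²; its least solution is c = 12, with 132 ≤
-- 144. Then d = 30, and s = 2 · 144 - 1 = 287 makes `s-large` an equality.
theorem5p2 mader (suc p) (s≤s 4≤p) n G ¬M = Colorable-mono {G = G} p≤ (hadwiger mader 12 30 287 (m≤m+n 2 10) ≤-refl (m≤m+n 132 12) ≤-refl G ¬M)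
  where
  open ≤-Reasoning
  p≤ : p ≤ 2 * suc p ∸ 6
  p≤ = m+n≤o⇒m≤o∸n p (begin
    p + 6             ≡⟨ +-assoc p 4 2 ⟨
    p + 4 + 2         ≤⟨ +-monoˡ-≤ 2 (+-monoʳ-≤ p 4≤p) ⟩
    p + p + 2         ≡⟨ solve 1 (λ p → p :+ p :+ con 2 := con 2 :* (con 1 :+ p)) refl p ⟩
    2 * suc p         ∎)
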